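{- Let $R$ be a System F type with $\mathrm{FV}(R)=\{X\}$ and $X\in^+ R$, and let $\gamma$ be any environment. Then for all terms $t,t'$: (i) $t\,\llbracket D_{\mathrm{ind}}\subseteq D_{\mathrm{param}}\rrbracket_\gamma\,t'$; (ii) if $R$ is $\forall^+$, then $t\,\llbracket D_{\mathrm{param}}\subseteq D_{\mathrm{ind}}\rrbracket_\gamma\,t'$; (iii) if $R$ is $\forall^+$, then $t\,\llbracket D_{\mathrm{ind}}\simeq D_{\mathrm{param}}\rrbracket_\gamma\,t'$.
   Context: Terms are those of the pure untyped $\lambda$-calculus, $t ::= x \mid \lambda x.t \mid t\,t'$, up to $\alpha$-equivalence; $=_{\beta\eta}$ is $\beta\eta$-convertibility. Relational types: $R ::= X \mid R\to R' \mid \forall X.R \mid R^{\cup} \mid R\cdot R' \mid t$ (the last is promotion of a term to a type); System F types are those built only from type variables, $\to$ and $\forall$. A relation $r$ on terms is $\beta\eta$-closed if $t_1\,r\,t_2$, $t_1'=_{\beta\eta}t_1$, $t_2'=_{\beta\eta}t_2$ imply $t_1'\,r\,t_2'$; $\mathcal{R}$ is the set of such relations. An environment $\gamma$ maps type variables to $\mathcal{R}$. Interpretation: $\llbracket X\rrbracket_\gamma=\gamma(X)$; $t\,\llbracket R\to R'\rrbracket_\gamma\,t'$ iff $a\,\llbracket R\rrbracket_\gamma\,a'$ implies $t\,a\,\llbracket R'\rrbracket_\gamma\,t'\,a'$ for all $a,a'$; $\llbracket \forall X.R\rrbracket_\gamma=\bigcap_{r\in\mathcal{R}}\llbracket R\rrbracket_{\gamma[X\mapsto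 r]}$; $t\,\llbracket R^\cup\rrbracket_\gamma\,t'$ iff $t'\,\llbracket R\rrbracket_\gamma\,t$; $t\,\llbracket R\cdot R'\rrbracket_\gamma\,t'$ iff $\exists t''$, $t\,\llbracket R\rrbracket_\gamma\,t''$ and $t''\,\llbracket R'\rrbracket_\gamma\,t'$; $\llbracket \hat t\rrbracket_\gamma=\{(t,t')\mid \hat t\,t=_{\beta\eta}t'\}$. Term abbreviations: $I:=\lambda x.x$, $K:=\lambda x.\lambda y.x$, $t\circ t':=\lambda x.t\,(t'\,x)$. Type abbreviations: $[t]R:=(K\,t)\cdot R$; $R[t]:=R\cdot (K\,t)^\cup$; $t\bullet R := t\cdot R\cdot t^\cup$; $R\subseteq R' := (K\,I)\bullet(R\to R')$; $R\Rightarrow R' := K\bullet (R\to R')$; $R\simeq R' := (R\subseteq R')\cdot(R'\subseteq R)$. Polarities $p\in\{+,-\}$, $\bar p$ the other. $X\in^p R$ is defined by: $X\in^+X$; $X\in^p Y$ for type variables $Y\neq X$; $X\in^p(R\to R')$ iff $X\in^{\bar p}R$ and $X\in^p R'$; $X\in^p\forall Y.R$ iff $X\in^p R$; $X\in^p (R\cdot R')$ iff $X\in^pR$ and $X\in^pR'$; $X\in^p R^\cup$ iff $X\in^p R$; $X\in^p t$ for promoted terms. The property $\forall^p$: type variables are $\forall^p$; if $R$ is $\forall^{\bar p}$ and $R'$ is $\forall^p$ then $R\to R'$ is $\forall^p$; if $R$ is $\forall^+$ then $\forall X.R$ is $\forall^+$; if $R$ is $\forall^p$ so is $R^\cup$;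 a promotion of $t=_{\beta\eta}I$ is $\forall^p$. For System F types define $\mathit{fmap}_{X,R}$ by recursion: $\mathit{fmap}_{X,X}=I$; $\mathit{fmap}_{X,Y}=K\,I$ ($Y\ne X$); $\mathit{fmap}_{X,R\to R'}=\lambda f.\lambda a.\,\mathit{fmap}_{X,R'}\,f\circ a\circ \mathit{fmap}_{X,R}\,f$; $\mathit{fmap}_{X,\forall Y.R}=\lambda f.\,\mathit{fmap}_{X,R}\,f$ (bound variable renamed to differ from $X$). Let $\mathit{fold}:=\lambda a.\lambda x.x\,a$ and $\mathit{in}_{X,R}:=\lambda x.\lambda a.\,a\,(\mathit{fmap}_{X,R}\,(\mathit{fold}\,a)\,x)$. Define $D_{\mathrm{param}}:=\forall X.(R\to X)\to X$ and $D_{\mathrm{ind}}:=\forall X.\big([\mathit{in}_{X,R}]\,(R\to X)\,[\mathit{in}_{X,R}]\big)\Rightarrow X$. -}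

module Defs where

open import Data.Nat using (ℕ; zero; suc; _≟_)
open import Data.Product using (∃-syntax; _×_)
open import Data.Sign using (Sign; +; -; opposite)
open import Function using (_⇔_)
open import Level using (Level; Lift; 0ℓ) renaming (suc to lsuc)
open import Relation.Binary.Core using (Rel)
open import Relation.Binary.PropositionalEquality using (_≡_; _≢_)
open import Relation.Nullary.Decidable using (yes; no)

------------------------------------------------------------------------
-- Pure untyped λ-terms

-- De Bruijn indices, so that propositional equality is α-equivalence.
-- Terms may be open, over an infinite supply of free variables.

infix  9 `_
infixl 7 _·_
infix  5 ƛ_

data Term : Set where
  `_  : ℕ → Term
  ƛ_  : Term → Term
  _·_ : Term → Term → Term

extᵣ : (ℕ → ℕ) → (ℕ → ℕ)
extᵣ ρ zero    = zero
extᵣ ρ (suc x) = suc (ρ x)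

ren : (ℕ → ℕ) → Term → Term
ren ρ (` x)   = ` ρ x
ren ρ (ƛ t)   = ƛ ren (extᵣ ρ) t
ren ρ (t · u) = ren ρ t · ren ρ u

wk : Term → Term
wk = ren suc

extₛ : (ℕ → Term) → (ℕ → Term)
extₛ σ zero    = ` zero
extₛ σ (suc x) = wk (σ x)

sub : (ℕ → Term) → Term → Term
sub σ (` x)   = σ x
sub σ (ƛ t)   = ƛ sub (extₛ σ) t
sub σ (t · u) = sub σ t · sub σ u

single : Term → ℕ → Term
single u zero    = u
single u (suc x) = ` x

infix 4 _=βη_

data _=βη_ : Rel Term 0ℓ where
  β        : ∀ {t u} → (ƛ t) · u =βη sub (single u) t
  η        : ∀ {t} → ƛ (wk t · ` 0) =βη t
  ƛ-cong   : ∀ {t t'} → t =βη t' → ƛ t =βη ƛ t'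
  ·-cong   : ∀ {t t' u u'} → t =βη t' → u =βη u' → t · u =βη t' · u'
  βη-refl  : ∀ {t} → t =βη t
  βη-sym   : ∀ {t t'} → t =βη t' → t' =βη t
  βη-trans : ∀ {t t' t''} → t =βη t' → t' =βη t'' → t =βη t''

I : Term
I = ƛ ` 0

K : Term
K = ƛ ƛ ` 1

infixr 6 _∘_

_∘_ : Term → Term → Term
t ∘ t' = ƛ (wk t · (wk t' · ` 0))

------------------------------------------------------------------------
-- Relational types

infix  8 _˘
infixr 7 _⨾_
infixr 6 _⟶_
infix  4 _∈FV_

-- Type variables are de Bruijn indices as well, bound by Π. Promoted
-- terms contain no type variables.
data RelType : Set where
  tvar : ℕ → RelType
  _⟶_  : RelType → RelType → RelType
  Π    : RelType → RelType             -- ∀X.R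
  _˘   : RelType → RelType             -- R^∪
  _⨾_  : RelType → RelType → RelType   -- R · R'
  ⌜_⌝  : Term → RelType

data SystemF : RelType → Set where
  tvar : ∀ X → SystemF (tvar X)
  _⟶_  : ∀ {R R'} → SystemF R → SystemF R' → SystemF (R ⟶ R')
  Π    : ∀ {R} → SystemF R → SystemF (Π R)

data _∈FV_ : ℕ → RelType → Set where
  tvar : ∀ {X} → X ∈FV tvar X
  ⟶ˡ   : ∀ {X R R'} → X ∈FV R → X ∈FV R ⟶ R'
  ⟶ʳ   : ∀ {X R R'} → X ∈FV R' → X ∈FV R ⟶ R'
  Π    : ∀ {X R} → suc X ∈FV R → X ∈FV Π R
  _˘   : ∀ {X R} → X ∈FV R → X ∈FV R ˘
  ⨾ˡ   : ∀ {X R R'} → X ∈FV R → X ∈FV R ⨾ R'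
  ⨾ʳ   : ∀ {X R R'} → X ∈FV R' → X ∈FV R ⨾ R'

FV_≐⁅_⁆ : RelType → ℕ → Set
FV R ≐⁅ X ⁆ = ∀ Y → Y ∈FV R ⇔ Y ≡ X

------------------------------------------------------------------------
-- Semantics

record 𝓡 (ℓ : Level) : Set (lsuc ℓ) where
  field
    rel    : Rel Term ℓ
    closed : ∀ {t₁ t₂ t₁' t₂'} →
             rel t₁ t₂ → t₁' =βη t₁ → t₂' =βη t₂ → rel t₁' t₂'

Env : (ℓ : Level) → Set (lsuc ℓ)
Env ℓ = ℕ → 𝓡 ℓ

infixr 5 _◂_

_◂_ : ∀ {ℓ} → 𝓡 ℓ → Env ℓ → Env ℓ
(r ◂ γ) zero    = r
(r ◂ γ) (suc X) = γ X

-- Agda's universes are predicative: Π ranges over the relations valued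
-- in Set ℓ, so interpretations are valued in Set (lsuc ℓ). Under
-- excluded middle every relation is equivalent to one valued in Set ℓ,
-- and this is then the usual impredicative interpretation.
⟦_⟧ : ∀ {ℓ} → RelType → Env ℓ → Rel Term (lsuc ℓ)
⟦_⟧ {ℓ} (tvar X) γ t t' = Lift (lsuc ℓ) (𝓡.rel (γ X) t t')
⟦ R ⟶ R' ⟧ γ t t'       = ∀ a a' → ⟦ R ⟧ γ a a' → ⟦ R' ⟧ γ (t · a) (t' · a')
⟦_⟧ {ℓ} (Π R) γ t t'    = ∀ (r : 𝓡 ℓ) → ⟦ R ⟧ (r ◂ γ) t t'
⟦ R ˘ ⟧ γ t t'          = ⟦ R ⟧ γ t' t
⟦ R ⨾ R' ⟧ γ t t'       = ∃[ t'' ] ⟦ R ⟧ γ t t'' × ⟦ R' ⟧ γ t'' t'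
⟦_⟧ {ℓ} ⌜ u ⌝ γ t t'    = Lift (lsuc ℓ) (u · t =βη t')

------------------------------------------------------------------------
-- Derived relational types

infixr 8 [_]ˡ_
infixl 9 _[_]ʳ
infixr 7 _∙_
infix  5 _⊆_ _≃_
infixr 5 _⇒_

-- [t]R
[_]ˡ_ : Term → RelType → RelType
[ t ]ˡ R = ⌜ K · t ⌝ ⨾ R

-- R[t]
_[_]ʳ : RelType → Term → RelType
R [ t ]ʳ = R ⨾ ⌜ K · t ⌝ ˘

_∙_ : Term → RelType → RelType
t ∙ R = ⌜ t ⌝ ⨾ R ⨾ ⌜ t ⌝ ˘

_⊆_ : RelType → RelType → RelType
R ⊆ R' = (K · I) ∙ (R ⟶ R')

_⇒_ : RelType → RelType → RelType
R ⇒ R' = K ∙ (R ⟶ R')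

_≃_ : RelType → RelType → RelType
R ≃ R' = (R ⊆ R') ⨾ (R' ⊆ R)

------------------------------------------------------------------------
-- Polarities

infix 4 _∈[_]_

data _∈[_]_ (X : ℕ) : Sign → RelType → Set where
  same  : X ∈[ + ] tvar X
  other : ∀ {p Y} → Y ≢ X → X ∈[ p ] tvar Y
  _⟶_   : ∀ {p R R'} → X ∈[ opposite p ] R → X ∈[ p ] R' → X ∈[ p ] R ⟶ R'
  Π     : ∀ {p R} → suc X ∈[ p ] R → X ∈[ p ] Π R
  _⨾_   : ∀ {p R R'} → X ∈[ p ] R → X ∈[ p ] R' → X ∈[ p ] R ⨾ R'
  _˘    : ∀ {p R} → X ∈[ p ] R → X ∈[ p ] R ˘
  ⌜_⌝   : ∀ {p} t → X ∈[ p ] ⌜ t ⌝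

-- The property ∀^p
data All∀ : Sign → RelType → Set where
  tvar : ∀ {p} X → All∀ p (tvar X)
  _⟶_  : ∀ {p R R'} → All∀ (opposite p) R → All∀ p R' → All∀ p (R ⟶ R')
  Π    : ∀ {R} → All∀ + R → All∀ + (Π R)
  _˘   : ∀ {p R} → All∀ p R → All∀ p (R ˘)
  ⌜_⌝  : ∀ {p t} → t =βη I → All∀ p ⌜ t ⌝

------------------------------------------------------------------------
-- Functorial action and the two representations of the datatype

fmap : ℕ → ∀ {R} → SystemF R → Term
fmap X (tvar Y) with Y ≟ X
... | yes _ = I
... | no  _ = K · I
fmap X (S ⟶ S') =
  ƛ ƛ ((wk (wk (fmap X S')) · ` 1) ∘ ` 0 ∘ (wk (wk (fmap X S)) · ` 1))
fmap X (Π S) = ƛ (wk (fmap (suc X) S) · ` 0)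

fold : Term
fold = ƛ ƛ (` 0 · ` 1)

inᵀ : ℕ → ∀ {R} → SystemF R → Term
inᵀ X S = ƛ ƛ (` 0 · (wk (wk (fmap X S)) · (fold · ` 0) · ` 1))

-- In Dparam and Dind the leading Π binds variable 0 of R directly, so
-- the X of the mathematics is variable 0 and no substitution is needed.

Dparam : RelType → RelType
Dparam R = Π ((R ⟶ tvar 0) ⟶ tvar 0)

Dind : ∀ {R} → SystemF R → RelType
Dind {R} S = Π (([ inᵀ 0 S ]ˡ (R ⟶ tvar 0) [ inᵀ 0 S ]ʳ) ⇒ tvar 0)

{-# OPTIONS --safe #-}
-- Unfolding the type abbreviations, x ⟦ Dind ⟧ x' says that x r x' for every r
-- such that in_R ⟦ R → X ⟧_r in_R.
--
-- Dind ⊆ Dparam: given a ⟦ R → X ⟧_r a', use induction at the relation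
-- { (y , y') ∣ (y a) r (y' a') }. Its hypothesis on in_R holds because fmap_R
-- acts on relations and fold a y = y a.
--
-- Dparam ⊆ Dind: if R is ∀⁺, then ⟦ R ⟧ at convertibility is contained in
-- convertibility, and the same holds for Dparam, so x = x'. Parametricity at
-- { (y , z) ∣ y a = z } relates in_R to a, because fmap_R I = I; hence
-- x in_R a = x' a for all a, so x in_R = x' = x. Parametricity at r, applied
-- to in_R itself, then gives x = (x in_R) r (x' in_R) = x'.
module Submission where

open import Defs
open import Data.Nat using (ℕ; zero; suc; _≟_; _<_; _<?_; _⊔_)
open import Data.Nat.Properties
  using (<-trans; <⇒≢; m<n⇒m<n⊔o; m<n⇒m<o⊔n; n<1+n)
open import Data.Product using (_×_; _,_; ∃-syntax)
open import Data.Sign using (+; -)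
open import Function using (_⇔_; mk⇔; Equivalence)
open import Level using (Level; Lift; lift; lower)
open import Relation.Binary.Bundles using (Setoid)
open import Relation.Binary.PropositionalEquality
  using (_≡_; _≢_; refl; sym; trans; cong; cong₂; module ≡-Reasoning)
open import Relation.Nullary using (yes; no; contradiction)
import Relation.Binary.Reasoning.Setoid as SetoidReasoning

private
  variable
    ℓ : Level
    R : RelType

-- Renaming and substitution

extᵣ-∘ : ∀ {ρ ρ' ρ'' : ℕ → ℕ} → (∀ x → ρ' (ρ x) ≡ ρ'' x) →
         ∀ x → extᵣ ρ' (extᵣ ρ x) ≡ extᵣ ρ'' x
extᵣ-∘ h zero    = refl
extᵣ-∘ h (suc x) = cong suc (h x)

ren-ren : ∀ {ρ ρ' ρ'' : ℕ → ℕ} → (∀ x → ρ' (ρ x) ≡ ρ'' x) →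
          ∀ t → ren ρ' (ren ρ t) ≡ ren ρ'' t
ren-ren h (` x)   = cong `_ (h x)
ren-ren h (ƛ t)   = cong ƛ_ (ren-ren (extᵣ-∘ h) t)
ren-ren h (t · u) = cong₂ _·_ (ren-ren h t) (ren-ren h u)

ren-wk : ∀ ρ t → ren (extᵣ ρ) (wk t) ≡ wk (ren ρ t)
ren-wk ρ t = trans (ren-ren (λ _ → refl) t) (sym (ren-ren (λ _ → refl) t))

sub-ren : ∀ {ρ : ℕ → ℕ} {σ τ : ℕ → Term} → (∀ x → σ (ρ x) ≡ τ x) →
          ∀ t → sub σ (ren ρ t) ≡ sub τ t
sub-ren h (` x)   = h x
sub-ren {ρ} {σ} {τ} h (ƛ t) = cong ƛ_ (sub-ren ext t)
  where
  ext : ∀ x → extₛ σ (extᵣ ρ x) ≡ extₛ τ x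
  ext zero    = refl
  ext (suc x) = cong wk (h x)
sub-ren h (t · u) = cong₂ _·_ (sub-ren h t) (sub-ren h u)

ren-sub : ∀ {ρ : ℕ → ℕ} {σ τ : ℕ → Term} → (∀ x → ren ρ (σ x) ≡ τ x) →
          ∀ t → ren ρ (sub σ t) ≡ sub τ t
ren-sub h (` x)   = h x
ren-sub {ρ} {σ} {τ} h (ƛ t) = cong ƛ_ (ren-sub ext t)
  where
  ext : ∀ x → ren (extᵣ ρ) (extₛ σ x) ≡ extₛ τ x
  ext zero    = refl
  ext (suc x) = trans (ren-wk ρ (σ x)) (cong wk (h x))
ren-sub h (t · u) = cong₂ _·_ (ren-sub h t) (ren-sub h u)

sub-wk : ∀ σ t → sub (extₛ σ) (wk t) ≡ wk (sub σ t)
sub-wk σ t = trans (sub-ren (λ _ → refl) t) (sym (ren-sub (λ _ → refl) t))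

sub-id : ∀ {σ : ℕ → Term} → (∀ x → σ x ≡ ` x) → ∀ t → sub σ t ≡ t
sub-id h (` x)   = h x
sub-id {σ} h (ƛ t) = cong ƛ_ (sub-id ext t)
  where
  ext : ∀ x → extₛ σ x ≡ ` x
  ext zero    = refl
  ext (suc x) = cong wk (h x)
sub-id h (t · u) = cong₂ _·_ (sub-id h t) (sub-id h u)

sub-single-wk : ∀ u t → sub (single u) (wk t) ≡ t
sub-single-wk u t = trans (sub-ren (λ _ → refl) t) (sub-id (λ _ → refl) t)

sub-single-wk² : ∀ u v t →
  sub (single v) (sub (extₛ (single u)) (wk (wk t))) ≡ t
sub-single-wk² u v t = begin
  sub (single v) (sub (extₛ (single u)) (wk (wk t)))
    ≡⟨ cong (sub (single v)) (sub-wk (single u) (wk t)) ⟩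
  sub (single v) (wk (sub (single u) (wk t)))
    ≡⟨ sub-single-wk v _ ⟩
  sub (single u) (wk t)
    ≡⟨ sub-single-wk u t ⟩
  t ∎
  where open ≡-Reasoning

sub-∘ : ∀ σ t u → sub σ (t ∘ u) ≡ sub σ t ∘ sub σ u
sub-∘ σ t u =
  cong₂ (λ t' u' → ƛ (t' · (u' · ` 0))) (sub-wk σ t) (sub-wk σ u)

ren-single : ∀ ρ u t →
  sub (single (ren ρ u)) (ren (extᵣ ρ) t) ≡ ren ρ (sub (single u) t)
ren-single ρ u t = trans (sub-ren pointwise t) (sym (ren-sub (λ _ → refl) t))
  where
  pointwise : ∀ x → single (ren ρ u) (extᵣ ρ x) ≡ ren ρ (single u x)
  pointwise zero    = refl
  pointwise (suc x) = refl

-- Conversion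

=βη-setoid : Setoid _ _
=βη-setoid = record
  { Carrier       = Term
  ; _≈_           = _=βη_
  ; isEquivalence = record { refl = βη-refl ; sym = βη-sym ; trans = βη-trans }
  }

module =βη-Reasoning = SetoidReasoning =βη-setoid

≡⇒=βη : ∀ {t t'} → t ≡ t' → t =βη t'
≡⇒=βη refl = βη-refl

·-congˡ : ∀ {t u u'} → u =βη u' → t · u =βη t · u'
·-congˡ = ·-cong βη-refl

·-congʳ : ∀ {t t' u} → t =βη t' → t · u =βη t' · u
·-congʳ p = ·-cong p βη-refl

β² : ∀ {t} u v →
  (ƛ ƛ t) · u · v =βη sub (single v) (sub (extₛ (single u)) t)
β² u v = βη-trans (·-congʳ β) β

-- Arbitrary renamings are covered, not only injective ones, because `bind` sends every index from
-- its bound on to `0`.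
ren-=βη : ∀ ρ {t t'} → t =βη t' → ren ρ t =βη ren ρ t'
ren-=βη ρ (β {t} {u})    = βη-trans β (≡⇒=βη (ren-single ρ u t))
ren-=βη ρ (η {t})        =
  βη-trans (≡⇒=βη (cong (λ t' → ƛ (t' · ` 0)) (ren-wk ρ t))) η
ren-=βη ρ (ƛ-cong p)     = ƛ-cong (ren-=βη (extᵣ ρ) p)
ren-=βη ρ (·-cong p q)   = ·-cong (ren-=βη ρ p) (ren-=βη ρ q)
ren-=βη ρ βη-refl        = βη-refl
ren-=βη ρ (βη-sym p)     = βη-sym (ren-=βη ρ p)
ren-=βη ρ (βη-trans p q) = βη-trans (ren-=βη ρ p) (ren-=βη ρ q)

-- Freshness and extensionality of conversion.

FVBound : Term → ℕ → Set
FVBound t n = ∀ {ρ ρ' : ℕ → ℕ} → (∀ {x} → x < n → ρ x ≡ ρ' x) →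
              ren ρ t ≡ ren ρ' t

-- Freshness is expressed by how renamings act, the form in which extensionality consumes it.
fvBound : ∀ t → ∃[ n ] FVBound t n
fvBound (` x) = suc x , λ h → cong `_ (h (n<1+n x))
fvBound (ƛ t) with fvBound t
-- The bound need not be sharp, so the body's bound is kept: `suc x < n` still gives `x < n`.
... | n , b = n , λ {ρ} {ρ'} h → cong ƛ_ (b (ext h))
  where
  ext : ∀ {ρ ρ' : ℕ → ℕ} → (∀ {x} → x < n → ρ x ≡ ρ' x) →
        ∀ {x} → x < n → extᵣ ρ x ≡ extᵣ ρ' x
  ext h {zero}  _ = refl
  ext h {suc x} p = cong suc (h (<-trans (n<1+n x) p))
fvBound (t · u) with fvBound t | fvBound u
... | m , b | n , c = m ⊔ n , λ h →
  cong₂ _·_ (b (λ p → h (m<n⇒m<n⊔o n p))) (c (λ p → h (m<n⇒m<o⊔n m p)))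

-- Turns t · ` n, for n fresh in t, into wk t · ` 0.
bind : ℕ → ℕ → ℕ
bind n x with x <? n
... | yes _ = suc x
... | no  _ = 0

bind-< : ∀ n {x} → x < n → bind n x ≡ suc x
bind-< n {x} p with x <? n
... | yes _ = refl
... | no ¬p = contradiction p ¬p

bind-≡ : ∀ n → bind n n ≡ 0
bind-≡ n with n <? n
... | yes p = contradiction refl (<⇒≢ p)
... | no _  = refl

-- The hypothesis is used at a variable fresh for both terms.
βη-ext : ∀ {t t'} → (∀ a → t · a =βη t' · a) → t =βη t'
βη-ext {t} {t'} h with fvBound t | fvBound t'
... | m , b | n , c = βη-trans (βη-sym η) (βη-trans (ƛ-cong wk-eq) η)
  where
  k = m ⊔ n

  eq : ren (bind k) t · ` bind k k =βη ren (bind k) t' · ` bind k k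
  eq = ren-=βη (bind k) (h (` k))

  wk-eq : wk t · ` 0 =βη wk t' · ` 0
  wk-eq = begin
    wk t · ` 0
      ≡⟨ cong₂ (λ s x → s · ` x) (b (λ p → bind-< k (m<n⇒m<n⊔o n p))) (bind-≡ k) ⟨
    ren (bind k) t · ` bind k k
      ≈⟨ eq ⟩
    ren (bind k) t' · ` bind k k
      ≡⟨ cong₂ (λ s x → s · ` x) (c (λ p → bind-< k (m<n⇒m<o⊔n m p))) (bind-≡ k) ⟩
    wk t' · ` 0 ∎
    where open =βη-Reasoning

-- Computation rules for the combinators and the functorial action.

I-β : ∀ t → I · t =βη t
I-β t = β

K-β : ∀ t u → K · t · u =βη t
K-β t u = βη-trans (β² t u) (≡⇒=βη (sub-single-wk u t))

KI-β : ∀ t u → K · I · t · u =βη u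
KI-β t u = βη-trans (·-congʳ (K-β I t)) (I-β u)

∘-β : ∀ t u v → (t ∘ u) · v =βη t · (u · v)
∘-β t u v = βη-trans β (≡⇒=βη
  (cong₂ (λ t' u' → t' · (u' · v)) (sub-single-wk v t) (sub-single-wk v u)))

fold-β : ∀ a x → fold · a · x =βη x · a
fold-β a x = βη-trans (β² a x) (≡⇒=βη (cong (x ·_) (sub-single-wk x a)))

fmap-⟶-β : ∀ X {R R'} (S : SystemF R) (S' : SystemF R') f a x →
  fmap X (S ⟶ S') · f · a · x =βη fmap X S' · f · (a · (fmap X S · f · x))
fmap-⟶-β X S S' f a x = begin
  fmap X (S ⟶ S') · f · a · x
    ≈⟨ ·-congʳ (β² f a) ⟩
  sub₂ (body' ∘ ` 0 ∘ body) · x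
    ≡⟨ cong (_· x) distribute ⟩
  (sub₂ body' ∘ a ∘ sub₂ body) · x
    ≡⟨ cong₂ (λ s' s → (s' ∘ a ∘ s) · x) (sub₂-body S') (sub₂-body S) ⟩
  (fmap X S' · f ∘ a ∘ fmap X S · f) · x
    ≈⟨ ∘-β _ _ x ⟩
  fmap X S' · f · ((a ∘ fmap X S · f) · x)
    ≈⟨ ·-congˡ (∘-β a _ x) ⟩
  fmap X S' · f · (a · (fmap X S · f · x)) ∎
  where
  open =βη-Reasoning

  sub₁ sub₂ : Term → Term
  sub₁ = sub (extₛ (single f))
  sub₂ t = sub (single a) (sub₁ t)

  body  = wk (wk (fmap X S)) · ` 1
  body' = wk (wk (fmap X S')) · ` 1

  sub₂-∘ : ∀ t u → sub₂ (t ∘ u) ≡ sub₂ t ∘ sub₂ u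
  sub₂-∘ t u = trans (cong (sub (single a)) (sub-∘ (extₛ (single f)) t u))
                     (sub-∘ (single a) (sub₁ t) (sub₁ u))

  distribute : sub₂ (body' ∘ ` 0 ∘ body) ≡ sub₂ body' ∘ a ∘ sub₂ body
  distribute = trans (sub₂-∘ body' (` 0 ∘ body))
                     (cong (sub₂ body' ∘_) (sub₂-∘ (` 0) body))

  sub₂-body : ∀ {R} (S : SystemF R) →
              sub₂ (wk (wk (fmap X S)) · ` 1) ≡ fmap X S · f
  sub₂-body S =
    cong₂ _·_ (sub-single-wk² f a (fmap X S)) (sub-single-wk a f)

fmap-Π-β : ∀ X {R} (S : SystemF R) f →
  fmap X (Π S) · f =βη fmap (suc X) S · f
fmap-Π-β X S f =
  βη-trans β (≡⇒=βη (cong (_· f) (sub-single-wk f (fmap (suc X) S))))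

in-β : ∀ X {R} (S : SystemF R) x a →
  inᵀ X S · x · a =βη a · (fmap X S · (fold · a) · x)
in-β X S x a = βη-trans (β² x a) (≡⇒=βη
  (cong₂ (λ F y → a · (F · (fold · a) · y))
    (sub-single-wk² x a (fmap X S)) (sub-single-wk a x)))

-- Identity law of the functor. At an arrow both sides are compared on an arbitrary argument, which
-- is where extensionality enters.
fmap-id : ∀ X (S : SystemF R) u → fmap X S · I · u =βη u
fmap-id X (tvar Y) u with Y ≟ X
... | yes _ = βη-trans (·-congʳ (I-β I)) (I-β u)
... | no  _ = KI-β I u
fmap-id X (S ⟶ S') u = βη-ext λ x → begin
  fmap X (S ⟶ S') · I · u · x                ≈⟨ fmap-⟶-β X S S' I u x ⟩
  fmap X S' · I · (u · (fmap X S · I · x))   ≈⟨ fmap-id X S' _ ⟩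
  u · (fmap X S · I · x)                     ≈⟨ ·-congˡ (fmap-id X S x) ⟩
  u · x                                      ∎
  where open =βη-Reasoning
fmap-id X (Π S) u = βη-trans (·-congʳ (fmap-Π-β X S I)) (fmap-id (suc X) S u)

-- Relational semantics

⟦⟧-closed : ∀ R (γ : Env ℓ) {t₁ t₂ t₁' t₂'} → ⟦ R ⟧ γ t₁ t₂ →
            t₁' =βη t₁ → t₂' =βη t₂ → ⟦ R ⟧ γ t₁' t₂'
⟦⟧-closed (tvar X) γ (lift h) p q = lift (𝓡.closed (γ X) h p q)
⟦⟧-closed (R ⟶ R') γ h p q = λ a a' k →
  ⟦⟧-closed R' γ (h a a' k) (·-congʳ p) (·-congʳ q)
⟦⟧-closed (Π R) γ h p q = λ r → ⟦⟧-closed R (r ◂ γ) (h r) p q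
⟦⟧-closed (R ˘) γ h p q = ⟦⟧-closed R γ h q p
⟦⟧-closed (R ⨾ R') γ (t , h , h') p q =
  t , ⟦⟧-closed R γ h p βη-refl , ⟦⟧-closed R' γ h' βη-refl q
⟦⟧-closed ⌜ u ⌝ γ (lift h) p q =
  lift (βη-trans (·-congˡ p) (βη-trans h (βη-sym q)))

-- Functorial action on relations.

infix 4 _⊢_,_∶_⇛_

-- Away from `X` the agreement is two-way, since `fmap⁺` uses it from `γ` to `δ` and `fmap⁻` from
-- `δ` to `γ`.
record _⊢_,_∶_⇛_ (X : ℕ) (f f' : Term) (γ δ : Env ℓ) : Set ℓ where
  field
    at    : ∀ {u u'} → 𝓡.rel (γ X) u u' → 𝓡.rel (δ X) (f · u) (f' · u')
    fixed : ∀ {Y u u'} → Y ≢ X → 𝓡.rel (γ Y) u u' ⇔ 𝓡.rel (δ Y) u u'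

open _⊢_,_∶_⇛_

◂-⇛ : ∀ {X f f'} {γ δ : Env ℓ} (r : 𝓡 ℓ) →
      X ⊢ f , f' ∶ γ ⇛ δ → suc X ⊢ f , f' ∶ r ◂ γ ⇛ r ◂ δ
◂-⇛ r m .at h = at m h
◂-⇛ r m .fixed {zero}  _   = mk⇔ (λ h → h) (λ h → h)
◂-⇛ r m .fixed {suc Y} Y≢X = fixed m (λ eq → Y≢X (cong suc eq))

mutual

  -- Polarity fixes the direction of transport, and the domain of an arrow reverses it; hence the
  -- mutual induction with `fmap⁻`.
  fmap⁺ : ∀ {X f f'} {γ δ : Env ℓ} (S : SystemF R) → X ∈[ + ] R →
          X ⊢ f , f' ∶ γ ⇛ δ → ∀ {u u'} → ⟦ R ⟧ γ u u' →
          ⟦ R ⟧ δ (fmap X S · f · u) (fmap X S · f' · u')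
  fmap⁺ {X = X} {δ = δ} (tvar Y) X∈ m (lift h) with Y ≟ X
  ... | yes refl = lift (𝓡.closed (δ X) (at m h)
                     (·-congʳ (I-β _)) (·-congʳ (I-β _)))
  ... | no Y≢X   = lift (𝓡.closed (δ Y) (Equivalence.to (fixed m Y≢X) h)
                     (KI-β _ _) (KI-β _ _))
  fmap⁺ {X = X} {δ = δ} (_⟶_ {R' = R'} S S') (X∈ ⟶ X∈') m h a a' k =
    -- The arguments are carried back to `γ`, fed to `h`, and the results carried forward to `δ`.
    ⟦⟧-closed R' δ (fmap⁺ S' X∈' m (h _ _ (fmap⁻ S X∈ m k)))
      (fmap-⟶-β X S S' _ _ a) (fmap-⟶-β X S S' _ _ a')
  fmap⁺ {X = X} {δ = δ} (Π {R} S) (Π X∈) m h r =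
    ⟦⟧-closed R (r ◂ δ) (fmap⁺ S X∈ (◂-⇛ r m) (h r))
      (·-congʳ (fmap-Π-β X S _)) (·-congʳ (fmap-Π-β X S _))

  fmap⁻ : ∀ {X f f'} {γ δ : Env ℓ} (S : SystemF R) → X ∈[ - ] R →
          X ⊢ f , f' ∶ γ ⇛ δ → ∀ {u u'} → ⟦ R ⟧ δ u u' →
          ⟦ R ⟧ γ (fmap X S · f · u) (fmap X S · f' · u')
  fmap⁻ {X = X} {γ = γ} (tvar Y) (other Y≢X) m (lift h) with Y ≟ X
  ... | yes eq = contradiction eq Y≢X
  ... | no _   = lift (𝓡.closed (γ Y) (Equivalence.from (fixed m Y≢X) h)
                   (KI-β _ _) (KI-β _ _))
  fmap⁻ {X = X} {γ = γ} (_⟶_ {R' = R'} S S') (X∈ ⟶ X∈') m h a a' k =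
    ⟦⟧-closed R' γ (fmap⁻ S' X∈' m (h _ _ (fmap⁺ S X∈ m k)))
      (fmap-⟶-β X S S' _ _ a) (fmap-⟶-β X S S' _ _ a')
  fmap⁻ {X = X} {γ = γ} (Π {R} S) (Π X∈) m h r =
    ⟦⟧-closed R (r ◂ γ) (fmap⁻ S X∈ (◂-⇛ r m) (h r))
      (·-congʳ (fmap-Π-β X S _)) (·-congʳ (fmap-Π-β X S _))

-- Collapse of `All∀` types to convertibility.

convertibility : 𝓡 ℓ
convertibility {ℓ} = record
  { rel    = λ t t' → Lift ℓ (t =βη t')
  ; closed = λ (lift h) p q → lift (βη-trans p (βη-trans h (βη-sym q)))
  }

-- Only free variables are constrained, so the rest of the environment may stay arbitrary.
ConvertibilityOn : RelType → Env ℓ → Set ℓ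
ConvertibilityOn R γ = ∀ {X} → X ∈FV R → ∀ t t' → 𝓡.rel (γ X) t t' ⇔ t =βη t'

mutual

  -- A quantifier is instantiated at `convertibility` itself. At an arrow, extensionality reduces
  -- the goal to one argument `a`, which the negative half relates to itself.
  All∀⁺⇒⊆=βη : {γ : Env ℓ} → All∀ + R → ConvertibilityOn R γ →
               ∀ {t t'} → ⟦ R ⟧ γ t t' → t =βη t'
  All∀⁺⇒⊆=βη (tvar X) c (lift h) = Equivalence.to (c tvar _ _) h
  All∀⁺⇒⊆=βη (A ⟶ A') c h = βη-ext λ a →
    All∀⁺⇒⊆=βη A' (λ Y∈ → c (⟶ʳ Y∈))
      (h a a (All∀⁻⇒=βη⊆ A (λ Y∈ → c (⟶ˡ Y∈)) βη-refl))
  All∀⁺⇒⊆=βη {R = Π R} {γ = γ} (Π A) c h = All∀⁺⇒⊆=βη A c' (h convertibility)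
    where
    c' : ConvertibilityOn R (convertibility ◂ γ)
    c' {zero}  _  = λ _ _ → mk⇔ lower lift
    c' {suc Y} Y∈ = c (Π Y∈)
  All∀⁺⇒⊆=βη (A ˘) c h = βη-sym (All∀⁺⇒⊆=βη A (λ Y∈ → c (Y∈ ˘)) h)
  All∀⁺⇒⊆=βη ⌜ p ⌝ c (lift h) =
    βη-trans (βη-sym (βη-trans (·-congʳ p) (I-β _))) h

  -- Dual half: at an arrow the positive half turns related arguments into convertible ones, and
  -- congruence finishes. No quantifier case arises, as `Π` is only ever `All∀ +`.
  All∀⁻⇒=βη⊆ : {γ : Env ℓ} → All∀ - R → ConvertibilityOn R γ →
               ∀ {t t'} → t =βη t' → ⟦ R ⟧ γ t t'
  All∀⁻⇒=βη⊆ (tvar X) c p = lift (Equivalence.from (c tvar _ _) p)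
  All∀⁻⇒=βη⊆ (A ⟶ A') c p a a' k =
    All∀⁻⇒=βη⊆ A' (λ Y∈ → c (⟶ʳ Y∈))
      (·-cong p (All∀⁺⇒⊆=βη A (λ Y∈ → c (⟶ˡ Y∈)) k))
  All∀⁻⇒=βη⊆ (A ˘) c p = All∀⁻⇒=βη⊆ A (λ Y∈ → c (Y∈ ˘)) (βη-sym p)
  All∀⁻⇒=βη⊆ ⌜ q ⌝ c p = lift (βη-trans (·-congʳ q) (βη-trans (I-β _) p))

-- The derived types

-- `K · I` sends both subjects to `I`, and `I` is related to itself at the arrow type exactly when
-- the inclusion holds; hence every pair `t`, `t'` is related.
⊆-intro : ∀ {R R'} (γ : Env ℓ) → (∀ {u u'} → ⟦ R ⟧ γ u u' → ⟦ R' ⟧ γ u u') →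
          ∀ t t' → ⟦ R ⊆ R' ⟧ γ t t'
⊆-intro {R' = R'} γ h t t' =
  K · I · t , lift βη-refl , K · I · t' ,
  (λ a a' k → ⟦⟧-closed R' γ (h k) (KI-β t a) (KI-β t' a')) ,
  lift βη-refl

Dind-elim : (S : SystemF R) (γ : Env ℓ) → ∀ {x x'} → ⟦ Dind S ⟧ γ x x' →
            ∀ r → ⟦ R ⟶ tvar 0 ⟧ (r ◂ γ) (inᵀ 0 S) (inᵀ 0 S) → 𝓡.rel r x x'
Dind-elim S γ {x} {x'} h r i with h r
... | s , lift p , s' , k , lift q = 𝓡.closed r
  -- The premise of `⇒` concerns dummy arguments that `K` erases; `I` serves as placeholder.
  (lower (k I I (inᵀ 0 S , lift (K-β _ I) , inᵀ 0 S , i , lift (K-β _ I))))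
  (βη-trans (βη-sym (K-β x I)) (·-congʳ p))
  (βη-trans (βη-sym (K-β x' I)) (·-congʳ q))

Dind-intro : (S : SystemF R) (γ : Env ℓ) → ∀ {x x'} →
             (∀ r → ⟦ R ⟶ tvar 0 ⟧ (r ◂ γ) (inᵀ 0 S) (inᵀ 0 S) → 𝓡.rel r x x') →
             ⟦ Dind S ⟧ γ x x'
Dind-intro {R = R} S γ {x} {x'} h r =
  K · x , lift βη-refl , K · x' , k , lift βη-refl
  where
  k : ∀ b b' → ⟦ [ inᵀ 0 S ]ˡ (R ⟶ tvar 0) [ inᵀ 0 S ]ʳ ⟧ (r ◂ γ) b b' →
      Lift _ (𝓡.rel r (K · x · b) (K · x' · b'))
  -- Whatever `b` and `b'` are, `p` and `q` make `s` and `s'` convertible to `inᵀ 0 S`, so `i` is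
  -- the required hypothesis up to closure.
  k b b' (s , lift p , s' , i , lift q) = lift (𝓡.closed r
    (h r (⟦⟧-closed (R ⟶ tvar 0) (r ◂ γ) i
      (βη-trans (βη-sym (K-β _ b)) p) (βη-trans (βη-sym (K-β _ b')) q)))
    (K-β x b) (K-β x' b'))

-- Inverse image of `r` along a pair of maps. Taking it along `fold · a` and `fold · a'` makes these
-- exactly the maps that `fmap⁺` lifts.
pullback : Term → Term → 𝓡 ℓ → 𝓡 ℓ
pullback f f' r = record
  { rel    = λ t t' → 𝓡.rel r (f · t) (f' · t')
  ; closed = λ h p q → 𝓡.closed r h (·-congˡ p) (·-congˡ q)
  }

pullback-⇛ : ∀ f f' r (γ : Env ℓ) →
             0 ⊢ f , f' ∶ pullback f f' r ◂ γ ⇛ r ◂ γ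
pullback-⇛ f f' r γ .at h = h
pullback-⇛ f f' r γ .fixed {zero}  0≢0 = contradiction refl 0≢0
pullback-⇛ f f' r γ .fixed {suc Y} _   = mk⇔ (λ h → h) (λ h → h)

-- From induction to parametricity.

Dind⊆Dparam : (S : SystemF R) → 0 ∈[ + ] R → (γ : Env ℓ) →
              ∀ {x x'} → ⟦ Dind S ⟧ γ x x' → ⟦ Dparam R ⟧ γ x x'
Dind⊆Dparam S 0∈ γ {x} {x'} h r a a' k = lift (𝓡.closed r
  (Dind-elim S γ h (pullback (fold · a) (fold · a') r) λ u u' v →
    -- By `in-β`, folding `inᵀ 0 S · u` amounts to applying `a` to the mapped `u`; `fmap⁺` relates
    -- the mapped terms and `k` sends them into `r`.
    lift (𝓡.closed r
      (lower (k _ _ (fmap⁺ S 0∈ (pullback-⇛ (fold · a) (fold · a') r γ) v)))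
      (βη-trans (fold-β a _) (in-β 0 S u a))
      (βη-trans (fold-β a' _) (in-β 0 S u' a'))))
  (βη-sym (fold-β a x))
  (βη-sym (fold-β a' x')))

-- From parametricity to induction.

module _ (S : SystemF R) (fv : FV R ≐⁅ 0 ⁆) (0∈ : 0 ∈[ + ] R) (A : All∀ + R)
         (γ : Env ℓ) {x x' : Term} (h : ⟦ Dparam R ⟧ γ x x') where

  private
    convertibilityOn : ConvertibilityOn R (convertibility ◂ γ)
    convertibilityOn {Y} Y∈ with Equivalence.to (fv Y) Y∈
    -- As `0` is the sole free variable of `R`, only the head of the environment is looked up.
    ... | refl = λ _ _ → mk⇔ lower lift

  -- `R` lies to the left of two arrows, so `All∀ + R` makes the whole body of `Dparam R` satisfy
  -- `All∀ +`.
  Dparam⇒=βη : x =βη x'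
  Dparam⇒=βη = All∀⁺⇒⊆=βη ((A ⟶ tvar 0) ⟶ tvar 0) c (h convertibility)
    where
    c : ConvertibilityOn ((R ⟶ tvar 0) ⟶ tvar 0) (convertibility ◂ γ)
    c (⟶ˡ (⟶ˡ Y∈))   = convertibilityOn Y∈
    c (⟶ˡ (⟶ʳ tvar)) = λ _ _ → mk⇔ lower lift
    c (⟶ʳ tvar)      = λ _ _ → mk⇔ lower lift

  -- Reflection law: rebuilding a datum with its own constructor returns it. The relation is
  -- lopsided, with a datum still to be folded on the left and a result on the right, so `x'`
  -- appears on the other side.
  Dparam⇒x·in=x' : x · inᵀ 0 S =βη x'
  Dparam⇒x·in=x' = βη-ext λ a →
    let r = pullback (fold · a) I convertibility
        in-r-a : ⟦ R ⟶ tvar 0 ⟧ (r ◂ γ) (inᵀ 0 S) a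
        in-r-a u u' v = lift (lift (begin
          fold · a · (inᵀ 0 S · u)            ≈⟨ fold-β a _ ⟩
          inᵀ 0 S · u · a                     ≈⟨ in-β 0 S u a ⟩
          a · (fmap 0 S · (fold · a) · u)
            -- `fmap⁺` lifts different maps on the two sides, `fold · a` and `I`; the collapse turns
            -- the resulting relatedness into conversion.
            ≈⟨ ·-congˡ (All∀⁺⇒⊆=βη A convertibilityOn
                 (fmap⁺ S 0∈ (pullback-⇛ (fold · a) I convertibility γ) v)) ⟩
          a · (fmap 0 S · I · u')             ≈⟨ ·-congˡ (fmap-id 0 S u') ⟩
          a · u'                              ≈⟨ I-β _ ⟨
          I · (a · u')                        ∎))
    in begin
      x · inᵀ 0 S · a             ≈⟨ fold-β a _ ⟨
      fold · a · (x · inᵀ 0 S)    ≈⟨ lower (lower (h r _ _ in-r-a)) ⟩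
      I · (x' · a)                ≈⟨ I-β _ ⟩
      x' · a                      ∎
    where open =βη-Reasoning

  Dparam⊆Dind : ⟦ Dind S ⟧ γ x x'
  Dparam⊆Dind = Dind-intro S γ λ r i → 𝓡.closed r (lower (h r _ _ i))
    (βη-trans Dparam⇒=βη (βη-sym Dparam⇒x·in=x'))
    (βη-trans (βη-sym Dparam⇒x·in=x') (·-congʳ Dparam⇒=βη))

mainTheorem2 : (ℓ : Level) (R : RelType) (S : SystemF R) →
    FV R ≐⁅ 0 ⁆ → 0 ∈[ + ] R →
    (γ : Env ℓ) (t t' : Term) →
    ⟦ Dind S ⊆ Dparam R ⟧ γ t t'
    × (All∀ + R → ⟦ Dparam R ⊆ Dind S ⟧ γ t t')
    × (All∀ + R → ⟦ Dind S ≃ Dparam R ⟧ γ t t')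
mainTheorem2 ℓ R S fv 0∈ γ t t' =
  ind⊆param t t' , (λ A → param⊆ind A t t') ,
  -- `≃` is a composite and asks for a middle term; `t` is chosen, since each inclusion relates all
  -- pairs.
  (λ A → t , ind⊆param t t , param⊆ind A t t')
  where
  ind⊆param : ∀ s s' → ⟦ Dind S ⊆ Dparam R ⟧ γ s s'
  ind⊆param = ⊆-intro {R = Dind S} {R' = Dparam R} γ (Dind⊆Dparam S 0∈ γ)

  param⊆ind : All∀ + R → ∀ s s' → ⟦ Dparam R ⊆ Dind S ⟧ γ s s'
  param⊆ind A =
    ⊆-intro {R = Dparam R} {R' = Dind S} γ (Dparam⊆Dind S fv 0∈ A γ)
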